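{- Let $F$ be a countable subfield of $\mathbb{R}$, let $\mathcal R=\langle R,<,+,-,\times\rangle$ be an ordered real closed field containing $F$ as a subfield with the order of $\mathcal R$ agreeing with that of $F$, and let $h$ be an $F$-bijection of $\mathcal R$. Then the structure $h^{ -1}[\mathcal R]$ is a model of $T[F]^*$.
   Context: An $F$-bijection of $\mathcal R$ is a map $h:R\to R$ that is an order-preserving bijection with $h(0)=0$, $h(1)=1$ and $h(ax)=ah(x)$ for all $x\in R$, $a\in F$. $h^{ -1}[\mathcal R]$ is the structure with domain $R$ in which $0,1,+,<$ are interpreted as in $\mathcal R$, each $c_a$ ($a\in F$) is interpreted as $a$, and $\times$ is interpreted as $x\otimes y=h^{ -1}(h(x)h(y))$. $T[F]^*$ is the theory in the language $\{0,1,+,\times,<\}\cup\{c_a:a\in F\}$ with axioms: (1) $0,+,<$ form an ordered abelian group; (2) the positive elements form a divisible ordered abelian group under $\times$ with identity $1$ and order $<$; (3a) $c_{a+b}=c_a+c_b$, (3b) $c_{ab}=c_a\times c_b$, (3c) $0<c_a$ for $a>0$; (4a) $c_{a+b}\times x=(c_a\times x)+(c_b\times x)$, (4b) $c_a\times(x+y)=(c_a\times x)+(c_a\times y)$, for all $a,b\in F$ and all $x,y$. -}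

module Defs where

open import Algebra.Bundles using (CommutativeRing)
open import Algebra.Bundles.Raw using (RawRing)
open import Algebra.Morphism.Structures using (IsRingMonomorphism)
open import Data.Empty.Polymorphic using (⊥)
open import Data.Fin using (Fin; #_)
open import Data.Nat.Base as ℕ using (ℕ; zero; suc)
import Data.Nat.Properties as ℕ
open import Data.Product.Base using (∃; _×_; _,_; proj₁; proj₂)
open import Data.Rational.Base as ℚ using (ℚ; 0ℚ; 1ℚ; ½; ∣_∣)
import Data.Rational.Properties as ℚ
open import Data.Rational.Solver using (module +-*-Solver)
open import Data.Sum.Base using (_⊎_)
open import Data.Vec.Base using (Vec; []; _∷_; lookup; foldr′; _∷ʳ_)
open import Function.Bundles using (Surjection)
open import Function.Structures using (IsBijection)
open import Level using (Level; 0ℓ; _⊔_) renaming (suc to lsuc)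
open import Relation.Binary.Bundles using (Setoid)
open import Relation.Binary.Core using (Rel; _Preserves_⟶_)
open import Relation.Binary.Definitions using (_Respects₂_)
import Relation.Binary.Construct.On as On
open import Relation.Binary.Morphism.Structures using (IsOrderMonomorphism)
open import Relation.Binary.PropositionalEquality as ≡ using (_≡_; refl; sym; trans; cong; subst)
open import Relation.Binary.Structures using (IsEquivalence; IsStrictTotalOrder)
open import Relation.Nullary using (¬_)
open import Relation.Nullary.Decidable using (True)
open import Relation.Unary using (Pred; _∈_; _⊆_)

private variable
  p ℓ : Level
  n : ℕ

-- The real numbers, as Cauchy sequences of rationals up to
-- the equivalence "the difference tends to 0".

IsCauchy : (ℕ → ℚ) → Set
IsCauchy x = ∀ {ε} → 0ℚ ℚ.< ε →
  ∃ λ N → ∀ {m n} → N ℕ.≤ m → N ℕ.≤ n → ∣ x m ℚ.- x n ∣ ℚ.< ε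

record ℝ : Set where
  constructor mkℝ
  field
    seq    : ℕ → ℚ
    cauchy : IsCauchy seq

open ℝ

infix 4 _≈ᴿ_ _<ᴿ_

_≈ᴿ_ : Rel ℝ 0ℓ
x ≈ᴿ y = ∀ {ε} → 0ℚ ℚ.< ε →
  ∃ λ N → ∀ {n} → N ℕ.≤ n → ∣ seq x n ℚ.- seq y n ∣ ℚ.< ε

_<ᴿ_ : Rel ℝ 0ℓ
x <ᴿ y = ∃ λ ε → 0ℚ ℚ.< ε ×
  ∃ λ N → ∀ {n} → N ℕ.≤ n → seq x n ℚ.+ ε ℚ.< seq y n

private
  module Identities where
    open +-*-Solver

    swap : ∀ a b → ℚ.- (a ℚ.- b) ≡ b ℚ.- a
    swap = solve 2 (λ a b → :- (a :- b) := b :- a) refl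

    neg-diff : ∀ a b → a ℚ.- b ≡ (ℚ.- b) ℚ.- (ℚ.- a)
    neg-diff = solve 2 (λ a b → a :- b := (:- b) :- (:- a)) refl

    add-back : ∀ a b → (a ℚ.- b) ℚ.+ b ≡ a
    add-back = solve 2 (λ a b → (a :- b) :+ b := a) refl

    telescope : ∀ a b c → (a ℚ.- b) ℚ.+ (b ℚ.- c) ≡ a ℚ.- c
    telescope = solve 3 (λ a b c → (a :- b) :+ (b :- c) := a :- c) refl

    sum-diff : ∀ a b c d → (a ℚ.- b) ℚ.+ (c ℚ.- d) ≡ (a ℚ.+ c) ℚ.- (b ℚ.+ d)
    sum-diff = solve 4 (λ a b c d → (a :- b) :+ (c :- d) := (a :+ c) :- (b :+ d)) refl

    product-diff : ∀ a b c d →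
      a ℚ.* (c ℚ.- d) ℚ.+ d ℚ.* (a ℚ.- b) ≡ a ℚ.* c ℚ.- b ℚ.* d
    product-diff = solve 4 (λ a b c d → a :* (c :- d) :+ d :* (a :- b) := a :* c :- b :* d) refl

  open Identities

  abstract
    left : ∀ m n {o} → m ℕ.⊔ n ℕ.≤ o → m ℕ.≤ o
    left m n = ℕ.m⊔n≤o⇒m≤o m n

    right : ∀ m n {o} → m ℕ.⊔ n ℕ.≤ o → n ℕ.≤ o
    right m n = ℕ.m⊔n≤o⇒n≤o m n

    half-pos : ∀ {ε} → 0ℚ ℚ.< ε → 0ℚ ℚ.< ½ ℚ.* ε
    half-pos {ε} 0<ε = subst (ℚ._< ½ ℚ.* ε) (ℚ.*-zeroʳ ½) (ℚ.*-monoʳ-<-pos ½ 0<ε)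

    halves : ∀ ε → ½ ℚ.* ε ℚ.+ ½ ℚ.* ε ≡ ε
    halves ε = trans (sym (ℚ.*-distribʳ-+ ε ½ ½)) (ℚ.*-identityˡ ε)

    add-halves : ∀ {a b ε} → a ℚ.< ½ ℚ.* ε → b ℚ.< ½ ℚ.* ε → a ℚ.+ b ℚ.< ε
    add-halves {a} {b} {ε} p q = subst (a ℚ.+ b ℚ.<_) (halves ε) (ℚ.+-mono-< p q)

    ∣x-x∣<ε : ∀ x {ε} → 0ℚ ℚ.< ε → ∣ x ℚ.- x ∣ ℚ.< ε
    ∣x-x∣<ε x 0<ε = subst (λ d → ∣ d ∣ ℚ.< _) (sym (ℚ.+-inverseʳ x)) 0<ε

    ∣x-y∣≡∣y-x∣ : ∀ x y → ∣ x ℚ.- y ∣ ≡ ∣ y ℚ.- x ∣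
    ∣x-y∣≡∣y-x∣ x y = trans (sym (ℚ.∣-p∣≡∣p∣ (x ℚ.- y))) (cong ∣_∣ (swap x y))

    triangle : ∀ x y z {ε} → ∣ x ℚ.- y ∣ ℚ.< ½ ℚ.* ε → ∣ y ℚ.- z ∣ ℚ.< ½ ℚ.* ε →
               ∣ x ℚ.- z ∣ ℚ.< ε
    triangle x y z {ε} p q = ℚ.≤-<-trans
      (subst (λ d → ∣ d ∣ ℚ.≤ ∣ x ℚ.- y ∣ ℚ.+ ∣ y ℚ.- z ∣)
        (telescope x y z)
        (ℚ.∣p+q∣≤∣p∣+∣q∣ (x ℚ.- y) (y ℚ.- z)))
      (add-halves p q)

    cauchy-const : ∀ q → IsCauchy (λ _ → q)
    cauchy-const q 0<ε = 0 , λ _ _ → ∣x-x∣<ε q 0<ε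

    cauchy-+ : ∀ {x y} → IsCauchy x → IsCauchy y → IsCauchy (λ n → x n ℚ.+ y n)
    cauchy-+ {x} {y} cx cy {ε} 0<ε with cx (half-pos 0<ε) | cy (half-pos 0<ε)
    ... | M , f | N , g = M ℕ.⊔ N , λ {m} {n} M⊔N≤m M⊔N≤n → ℚ.≤-<-trans
      (subst (λ d → ∣ d ∣ ℚ.≤ ∣ x m ℚ.- x n ∣ ℚ.+ ∣ y m ℚ.- y n ∣)
        (sum-diff (x m) (x n) (y m) (y n))
        (ℚ.∣p+q∣≤∣p∣+∣q∣ (x m ℚ.- x n) (y m ℚ.- y n)))
      (add-halves
        (f (left M N M⊔N≤m) (left M N M⊔N≤n))
        (g (right M N M⊔N≤m) (right M N M⊔N≤n)))

    cauchy-neg : ∀ {x} → IsCauchy x → IsCauchy (λ n → ℚ.- x n)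
    cauchy-neg {x} cx 0<ε with cx 0<ε
    ... | N , f = N , λ {m} {n} N≤m N≤n → subst (ℚ._< _)
      (cong ∣_∣ (neg-diff (x n) (x m)))
      (f N≤n N≤m)

    eventually-bounded : ∀ {x} → IsCauchy x →
      ∃ λ B → ∃ λ N → ∀ {n} → N ℕ.≤ n → ∣ x n ∣ ℚ.< B
    eventually-bounded {x} cx with cx (ℚ.positive⁻¹ 1ℚ)
    ... | N , f = 1ℚ ℚ.+ ∣ x N ∣ , N , λ {n} N≤n → ℚ.≤-<-trans
      (subst (λ d → ∣ d ∣ ℚ.≤ ∣ x n ℚ.- x N ∣ ℚ.+ ∣ x N ∣)
        (add-back (x n) (x N))
        (ℚ.∣p+q∣≤∣p∣+∣q∣ (x n ℚ.- x N) (x N)))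
      (ℚ.+-monoˡ-< ∣ x N ∣ (f N≤n ℕ.≤-refl))

    scale : ∀ {a B} → ∣ a ∣ ℚ.< B → ∀ {ε} → 0ℚ ℚ.< ε →
      ∃ λ δ → 0ℚ ℚ.< δ × (∀ {b d} → ∣ b ∣ ℚ.< B → ∣ d ∣ ℚ.< δ → ∣ b ℚ.* d ∣ ℚ.< ε)
    scale {a} {B} a<B {ε} 0<ε = δ , 0<δ , λ {b} {d} b<B d<δ →
      subst (ℚ._< ε) (sym (ℚ.∣p*q∣≡∣p∣*∣q∣ b d)) (ℚ.≤-<-trans
        (ℚ.*-monoʳ-≤-nonNeg ∣ d ∣ {{ℚ.∣-∣-nonNeg d}} (ℚ.<⇒≤ b<B))
        (subst (B ℚ.* ∣ d ∣ ℚ.<_) B*δ≡ε (ℚ.*-monoʳ-<-pos B d<δ)))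
      where
      instance
        B-pos : ℚ.Positive B
        B-pos = ℚ.positive (ℚ.≤-<-trans (ℚ.0≤∣p∣ a) a<B)
        B≢0 : ℚ.NonZero B
        B≢0 = ℚ.pos⇒nonZero B
        1/B-pos : ℚ.Positive (ℚ.1/ B)
        1/B-pos = ℚ.1/pos⇒pos B
      δ : ℚ
      δ = (ℚ.1/ B) ℚ.* ε
      0<δ : 0ℚ ℚ.< δ
      0<δ = subst (ℚ._< δ) (ℚ.*-zeroʳ (ℚ.1/ B)) (ℚ.*-monoʳ-<-pos (ℚ.1/ B) 0<ε)
      B*δ≡ε : B ℚ.* δ ≡ ε
      B*δ≡ε = trans (sym (ℚ.*-assoc B (ℚ.1/ B) ε))
        (trans (cong (ℚ._* ε) (ℚ.*-inverseʳ B)) (ℚ.*-identityˡ ε))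

    product-bound : ∀ {ε} x x′ y y′ →
      ∣ x ℚ.* (y ℚ.- y′) ∣ ℚ.< ½ ℚ.* ε → ∣ y′ ℚ.* (x ℚ.- x′) ∣ ℚ.< ½ ℚ.* ε →
      ∣ x ℚ.* y ℚ.- x′ ℚ.* y′ ∣ ℚ.< ε
    product-bound x x′ y y′ p q = ℚ.≤-<-trans
      (subst (λ d → ∣ d ∣ ℚ.≤ ∣ x ℚ.* (y ℚ.- y′) ∣ ℚ.+ ∣ y′ ℚ.* (x ℚ.- x′) ∣)
        (product-diff x x′ y y′)
        (ℚ.∣p+q∣≤∣p∣+∣q∣ (x ℚ.* (y ℚ.- y′)) (y′ ℚ.* (x ℚ.- x′))))
      (add-halves p q)

    cauchy-* : ∀ {x y} → IsCauchy x → IsCauchy y → IsCauchy (λ n → x n ℚ.* y n)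
    cauchy-* {x} {y} cx cy {ε} 0<ε =
      let A , K , x<A = eventually-bounded cx
          B , L , y<B = eventually-bounded cy
          δ , 0<δ , sx = scale {x K} {A} (x<A ℕ.≤-refl) (half-pos 0<ε)
          η , 0<η , sy = scale {y L} {B} (y<B ℕ.≤-refl) (half-pos 0<ε)
          M , g = cy 0<δ
          N , f = cx 0<η
          K≤ = λ {i} (h : K ℕ.⊔ L ℕ.⊔ (M ℕ.⊔ N) ℕ.≤ i) →
                 left K L (left (K ℕ.⊔ L) (M ℕ.⊔ N) h)
          L≤ = λ {i} (h : K ℕ.⊔ L ℕ.⊔ (M ℕ.⊔ N) ℕ.≤ i) →
                 right K L (left (K ℕ.⊔ L) (M ℕ.⊔ N) h)
          M≤ = λ {i} (h : K ℕ.⊔ L ℕ.⊔ (M ℕ.⊔ N) ℕ.≤ i) →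
                 left M N (right (K ℕ.⊔ L) (M ℕ.⊔ N) h)
          N≤ = λ {i} (h : K ℕ.⊔ L ℕ.⊔ (M ℕ.⊔ N) ℕ.≤ i) →
                 right M N (right (K ℕ.⊔ L) (M ℕ.⊔ N) h)
      in K ℕ.⊔ L ℕ.⊔ (M ℕ.⊔ N) , λ {m} {n} ≤m ≤n →
        product-bound (x m) (x n) (y m) (y n)
          (sx {x m} {y m ℚ.- y n} (x<A (K≤ ≤m)) (g (M≤ ≤m) (M≤ ≤n)))
          (sy {y n} {x m ℚ.- x n} (y<B (L≤ ≤n)) (f (N≤ ≤m) (N≤ ≤n)))

infixl 6 _+ᴿ_
infixl 7 _*ᴿ_
infix  8 -ᴿ_

0ᴿ 1ᴿ : ℝ
0ᴿ = mkℝ (λ _ → 0ℚ) (cauchy-const 0ℚ)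
1ᴿ = mkℝ (λ _ → 1ℚ) (cauchy-const 1ℚ)

_+ᴿ_ _*ᴿ_ : ℝ → ℝ → ℝ
x +ᴿ y = mkℝ (λ n → seq x n ℚ.+ seq y n) (cauchy-+ {seq x} {seq y} (cauchy x) (cauchy y))
x *ᴿ y = mkℝ (λ n → seq x n ℚ.* seq y n) (cauchy-* {seq x} {seq y} (cauchy x) (cauchy y))

-ᴿ_ : ℝ → ℝ
-ᴿ x = mkℝ (λ n → ℚ.- seq x n) (cauchy-neg {seq x} (cauchy x))

abstract
  ≈ᴿ-isEquivalence : IsEquivalence _≈ᴿ_
  ≈ᴿ-isEquivalence = record
    { refl  = λ {x} 0<ε → 0 , λ {n} _ → ∣x-x∣<ε (seq x n) 0<ε
    ; sym   = λ {x} {y} x≈y 0<ε → let N , f = x≈y 0<ε in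
        N , λ {n} N≤n → subst (ℚ._< _) (∣x-y∣≡∣y-x∣ (seq x n) (seq y n)) (f N≤n)
    ; trans = λ {x} {y} {z} x≈y y≈z 0<ε →
        let M , f = x≈y (half-pos 0<ε)
            N , g = y≈z (half-pos 0<ε)
        in M ℕ.⊔ N , λ {n} M⊔N≤n → triangle (seq x n) (seq y n) (seq z n)
             (f (left M N M⊔N≤n)) (g (right M N M⊔N≤n))
    }

ℝ-setoid : Setoid 0ℓ 0ℓ
ℝ-setoid = record { isEquivalence = ≈ᴿ-isEquivalence }

record Subfield p : Set (lsuc p) where
  field
    member   : Pred ℝ p
    resp     : ∀ {x y} → x ≈ᴿ y → x ∈ member → y ∈ member
    0-closed : 0ᴿ ∈ member
    1-closed : 1ᴿ ∈ member
    +-closed : ∀ {x y} → x ∈ member → y ∈ member → x +ᴿ y ∈ member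
    *-closed : ∀ {x y} → x ∈ member → y ∈ member → x *ᴿ y ∈ member
    neg-closed : ∀ {x} → x ∈ member → -ᴿ x ∈ member
    inv-closed : ∀ {x} → x ∈ member → ¬ x ≈ᴿ 0ᴿ →
                 ∃ λ y → y ∈ member × x *ᴿ y ≈ᴿ 1ᴿ

  Carrier : Set p
  Carrier = ∃ member

  setoid : Setoid p 0ℓ
  setoid = On.setoid ℝ-setoid (proj₁ {B = member})

  infix  4 _≈_ _<_
  infixl 6 _+_
  infixl 7 _*_

  _≈_ _<_ : Rel Carrier 0ℓ
  a ≈ b = proj₁ a ≈ᴿ proj₁ b
  a < b = proj₁ a <ᴿ proj₁ b

  0# 1# : Carrier
  0# = 0ᴿ , 0-closed
  1# = 1ᴿ , 1-closed

  _+_ _*_ : Carrier → Carrier → Carrier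
  (x , x∈) + (y , y∈) = x +ᴿ y , +-closed x∈ y∈
  (x , x∈) * (y , y∈) = x *ᴿ y , *-closed x∈ y∈

  -_ : Carrier → Carrier
  - (x , x∈) = -ᴿ x , neg-closed x∈

  rawRing : RawRing p 0ℓ
  rawRing = record
    { Carrier = Carrier ; _≈_ = _≈_ ; _+_ = _+_ ; _*_ = _*_
    ; -_ = -_ ; 0# = 0# ; 1# = 1# }

-- A subfield is never empty, so countable means enumerated by ℕ.
Countable : Subfield p → Set p
Countable F = Surjection (≡.setoid ℕ) (Subfield.setoid F)

record OrderedField ℓ : Set (lsuc ℓ) where
  field
    commutativeRing : CommutativeRing ℓ ℓ

  open CommutativeRing commutativeRing public

  infix 4 _<_

  field
    _<_                : Rel Carrier ℓ
    isStrictTotalOrder : IsStrictTotalOrder _≈_ _<_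
    0≉1                : ¬ 0# ≈ 1#
    inverse            : ∀ {x} → ¬ x ≈ 0# → ∃ λ y → x * y ≈ 1#
    +-mono-<           : ∀ {x y} z → x < y → x + z < y + z
    *-pos              : ∀ {x y} → 0# < x → 0# < y → 0# < x * y

record RealClosedField ℓ : Set (lsuc ℓ) where
  field
    orderedField : OrderedField ℓ

  open OrderedField orderedField public

  -- eval (a₀ ∷ a₁ ∷ … ∷ []) x = a₀ + x * (a₁ + x * …)
  eval : Vec Carrier n → Carrier → Carrier
  eval as x = foldr′ (λ a r → a + x * r) 0# as

  field
    square-root : ∀ {x} → 0# < x → ∃ λ y → y * y ≈ x
    -- The polynomial a₀ + a₁ X + … + a₂ₖ X²ᵏ + b X²ᵏ⁺¹ of odd degree.
    odd-root    : ∀ k (as : Vec Carrier (suc (2 ℕ.* k))) {b} → ¬ b ≈ 0# →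
                  ∃ λ x → eval (as ∷ʳ b) x ≈ 0#

-- Inclusion of F in R as a subfield with the order induced from R,
-- up to identifying F with its image.
record OrderedSubfieldOf (F : Subfield p) (R : RealClosedField ℓ) : Set (p ⊔ ℓ) where
  private
    module F = Subfield F
    module R = RealClosedField R
  field
    ι                   : F.Carrier → R.Carrier
    isRingMonomorphism  : IsRingMonomorphism F.rawRing R.rawRing ι
    isOrderMonomorphism : IsOrderMonomorphism F._≈_ R._≈_ F._<_ R._<_ ι

  open IsRingMonomorphism isRingMonomorphism public using (⟦⟧-cong)

record FBijection {F : Subfield p} {R : RealClosedField ℓ}
                  (F⊆R : OrderedSubfieldOf F R) : Set (p ⊔ ℓ) where
  open RealClosedField R
  open OrderedSubfieldOf F⊆R using (ι)
  field
    h           : Carrier → Carrier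
    isBijection : IsBijection _≈_ _≈_ h
    order       : h Preserves _<_ ⟶ _<_
    h-0         : h 0# ≈ 0#
    h-1         : h 1# ≈ 1#
    homogeneous : ∀ a x → h (ι a * x) ≈ ι a * h x

  open IsBijection isBijection public using (injective; surjective) renaming (cong to h-cong)

  h⁻¹ : Carrier → Carrier
  h⁻¹ y = proj₁ (surjective y)

  h∘h⁻¹ : ∀ y → h (h⁻¹ y) ≈ y
  h∘h⁻¹ y = proj₂ (surjective y) (CommutativeRing.refl commutativeRing)

-- First-order syntax over {0, 1, +, ×, <} ∪ {c a : a ∈ C}, with ⊞, ⊠, ≺, ≐
-- for +, ×, <, =.  Terms and formulas are indexed by their number of free variables;
-- variables are de Bruijn indices.

infixl 7 _⊠_
infixl 6 _⊞_
infix  5 _≐_ _≺_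
infixr 4 _∧̇_
infixr 3 _∨̇_
infixr 2 _⇒̇_

data Term (C : Set p) (n : ℕ) : Set p where
  var     : Fin n → Term C n
  𝟎 𝟏     : Term C n
  _⊞_ _⊠_ : Term C n → Term C n → Term C n
  c       : C → Term C n

data Formula (C : Set p) (n : ℕ) : Set p where
  _≐_ _≺_        : Term C n → Term C n → Formula C n
  ⊥̇              : Formula C n
  _∧̇_ _∨̇_ _⇒̇_   : Formula C n → Formula C n → Formula C n
  ∀̇ ∃̇            : Formula C (suc n) → Formula C n

Sentence : Set p → Set p
Sentence C = Formula C 0

Theory : Set p → Set (lsuc p)
Theory {p} C = Pred (Sentence C) p

¬̇_ : {C : Set p} → Formula C n → Formula C n
¬̇ φ = φ ⇒̇ ⊥̇

⊤̇ : {C : Set p} → Formula C n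
⊤̇ = ¬̇ ⊥̇

-- Equality is interpreted by _≈_, which therefore has to be a congruence.
-- Constant symbols are taken up to the equality of C: representatives of
-- the same element of C name the same element of the structure.
record Structure (C : Setoid p 0ℓ) ℓ : Set (p ⊔ lsuc ℓ) where
  private module C = Setoid C
  field
    Carrier       : Set ℓ
    _≈_           : Rel Carrier ℓ
    isEquivalence : IsEquivalence _≈_
    0# 1#         : Carrier
    _+_ _⊗_      : Carrier → Carrier → Carrier
    const         : C.Carrier → Carrier
    _<_           : Rel Carrier ℓ
    +-cong        : ∀ {x x′ y y′} → x ≈ x′ → y ≈ y′ → (x + y) ≈ (x′ + y′)
    ⊗-cong       : ∀ {x x′ y y′} → x ≈ x′ → y ≈ y′ → (x ⊗ y) ≈ (x′ ⊗ y′)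
    const-cong    : ∀ {a b} → a C.≈ b → const a ≈ const b
    <-resp-≈      : _<_ Respects₂ _≈_

  ⟦_⟧ : Term C.Carrier n → Vec Carrier n → Carrier
  ⟦ var i ⟧ ρ = lookup ρ i
  ⟦ 𝟎 ⟧     ρ = 0#
  ⟦ 𝟏 ⟧     ρ = 1#
  ⟦ s ⊞ t ⟧ ρ = ⟦ s ⟧ ρ + ⟦ t ⟧ ρ
  ⟦ s ⊠ t ⟧ ρ = ⟦ s ⟧ ρ ⊗ ⟦ t ⟧ ρ
  ⟦ c a ⟧   ρ = const a

  -- ∨̇ and ∃̇ are read constructively: a disjunct, respectively a witness,
  -- is part of the evidence.
  Sat : Formula C.Carrier n → Vec Carrier n → Set ℓ
  Sat (s ≐ t)  ρ = ⟦ s ⟧ ρ ≈ ⟦ t ⟧ ρ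
  Sat (s ≺ t)  ρ = ⟦ s ⟧ ρ < ⟦ t ⟧ ρ
  Sat ⊥̇        ρ = ⊥
  Sat (φ ∧̇ ψ) ρ = Sat φ ρ × Sat ψ ρ
  Sat (φ ∨̇ ψ) ρ = Sat φ ρ ⊎ Sat ψ ρ
  Sat (φ ⇒̇ ψ) ρ = Sat φ ρ → Sat ψ ρ
  Sat (∀̇ φ)    ρ = ∀ x → Sat φ (x ∷ ρ)
  Sat (∃̇ φ)    ρ = ∃ λ x → Sat φ (x ∷ ρ)

infix 4 _⊨_

_⊨_ : {C : Setoid p 0ℓ} → Structure C ℓ → Theory (Setoid.Carrier C) → Set (p ⊔ ℓ)
M ⊨ T = T ⊆ (λ φ → Structure.Sat M φ [])

v : {C : Set p} → ∀ m {m<n : True (m ℕ.<? n)} → Term C n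
v m {m<n} = var (#_ m {m<n = m<n})

-- Axioms saying that the elements satisfying D form an ordered abelian
-- group under _∙_ with identity e and order ≺.  Under three quantifiers
-- the variables are v 2, v 1, v 0 from the outermost inwards.
module OrderedAbelianGroup {p} {C : Set p}
  (D : ∀ {n} → Term C n → Formula C n)
  (_∙_ : ∀ {n} → Term C n → Term C n → Term C n)
  (e : ∀ {n} → Term C n)
  where

  ∀ᴰ ∃ᴰ : Formula C (suc n) → Formula C n
  ∀ᴰ φ = ∀̇ (D (v 0) ⇒̇ φ)
  ∃ᴰ φ = ∃̇ (D (v 0) ∧̇ φ)

  power : Term C n → ℕ → Term C n
  power t zero    = e
  power t (suc k) = t ∙ power t k

  data Axiom : Theory C where
    closed      : Axiom (∀ᴰ (∀ᴰ (D (v 1 ∙ v 0))))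
    e-closed    : Axiom (D e)
    associative : Axiom (∀ᴰ (∀ᴰ (∀ᴰ ((v 2 ∙ v 1) ∙ v 0 ≐ v 2 ∙ (v 1 ∙ v 0)))))
    commutative : Axiom (∀ᴰ (∀ᴰ (v 1 ∙ v 0 ≐ v 0 ∙ v 1)))
    identity    : Axiom (∀ᴰ (v 0 ∙ e ≐ v 0))
    inverse     : Axiom (∀ᴰ (∃ᴰ (v 1 ∙ v 0 ≐ e)))
    irreflexive : Axiom (∀ᴰ (¬̇ (v 0 ≺ v 0)))
    transitive  : Axiom (∀ᴰ (∀ᴰ (∀ᴰ (v 2 ≺ v 1 ⇒̇ v 1 ≺ v 0 ⇒̇ v 2 ≺ v 0))))
    total       : Axiom (∀ᴰ (∀ᴰ (v 1 ≺ v 0 ∨̇ v 1 ≐ v 0 ∨̇ v 0 ≺ v 1)))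
    monotone    : Axiom (∀ᴰ (∀ᴰ (∀ᴰ (v 2 ≺ v 1 ⇒̇ v 2 ∙ v 0 ≺ v 1 ∙ v 0))))

  data Divisibility : Theory C where
    divisible : ∀ k .{{_ : ℕ.NonZero k}} →
                Divisibility (∀ᴰ (∃ᴰ (power (v 0) k ≐ v 1)))

module Additive {p} {C : Set p} =
  OrderedAbelianGroup {C = C} (λ _ → ⊤̇) _⊞_ 𝟎

module PositiveMultiplicative {p} {C : Set p} =
  OrderedAbelianGroup {C = C} (λ t → 𝟎 ≺ t) _⊠_ 𝟏

data T[_]* (F : Subfield p) : Theory (Subfield.Carrier F) where
  ax1  : ∀ {φ} → φ ∈ Additive.Axiom → T[ F ]* φ
  ax2  : ∀ {φ} → φ ∈ PositiveMultiplicative.Axiom → T[ F ]* φ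
  ax2′ : ∀ {φ} → φ ∈ PositiveMultiplicative.Divisibility → T[ F ]* φ
  ax3a : ∀ a b → let open Subfield F in
         T[ F ]* (c (a + b) ≐ c a ⊞ c b)
  ax3b : ∀ a b → let open Subfield F in
         T[ F ]* (c (a * b) ≐ c a ⊠ c b)
  ax3c : ∀ a → let open Subfield F in 0# < a →
         T[ F ]* (𝟎 ≺ c a)
  ax4a : ∀ a b → let open Subfield F in
         T[ F ]* (∀̇ (c (a + b) ⊠ v 0 ≐ (c a ⊠ v 0) ⊞ (c b ⊠ v 0)))
  ax4b : ∀ a →
         T[ F ]* (∀̇ (∀̇ (c a ⊠ (v 1 ⊞ v 0) ≐ (c a ⊠ v 1) ⊞ (c a ⊠ v 0))))

pullback : {F : Subfield p} (R : RealClosedField ℓ) {F⊆R : OrderedSubfieldOf F R} →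
           FBijection F⊆R → Structure (Subfield.setoid F) ℓ
pullback R {F⊆R} h-bij = record
  { Carrier       = R.Carrier
  ; _≈_           = R._≈_
  ; isEquivalence = R.isEquivalence
  ; 0#            = R.0#
  ; 1#            = R.1#
  ; _+_           = R._+_
  ; _⊗_           = λ x y → h⁻¹ (h x R.* h y)
  ; const         = ι
  ; _<_           = R._<_
  ; +-cong        = R.+-cong
  ; ⊗-cong        = λ x≈x′ y≈y′ → injective (R.trans (h∘h⁻¹ _)
                      (R.trans (R.*-cong (h-cong x≈x′) (h-cong y≈y′)) (R.sym (h∘h⁻¹ _))))
  ; const-cong    = ⟦⟧-cong
  ; <-resp-≈      = IsStrictTotalOrder.<-resp-≈ R.isStrictTotalOrder
  }
  where
  module R = RealClosedField R
  open OrderedSubfieldOf F⊆R using (ι; ⟦⟧-cong)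
  open FBijection h-bij

syntax pullback R h = h ⁻¹[ R ]

{-# OPTIONS --safe #-}

-- The map h is an isomorphism from h⁻¹[R] onto R for × and <, so the ordered group axioms
-- for the positive elements are those of R.  Divisibility there is the existence of
-- positive k-th roots in R, by strong induction on k: halve an even k by a square root,
-- and for odd k solve Xᵏ = a.  Homogeneity gives h (ι a) = ι a, so that multiplying by a
-- constant means the same in h⁻¹[R] as in R.

module Submission where

open import Defs
open import Algebra.Morphism.Structures using (IsRingMonomorphism)
import Algebra.Properties.Group as GroupProperties
import Algebra.Properties.Ring as RingProperties
import Algebra.Properties.Semiring.Exp as Exp
open import Data.Fin.Base using (zero; suc)
open import Data.Nat.Base as ℕ using (zero; suc)
open import Data.Nat.DivMod using (_divMod_; result)
open import Data.Nat.Induction using (<-rec)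
import Data.Nat.Properties as ℕ
open import Data.Product.Base using (∃; _×_; _,_)
open import Data.Sum.Base using (_⊎_; inj₁; inj₂)
open import Data.Vec.Base using ([]; _∷_; _∷ʳ_; replicate)
open import Relation.Binary.Definitions using (tri<; tri≈; tri>)
open import Relation.Binary.Morphism.Structures using (IsOrderMonomorphism)
import Relation.Binary.PropositionalEquality as ≡
open import Relation.Binary.Structures using (IsStrictTotalOrder)
import Relation.Binary.Reasoning.Setoid as SetoidReasoning
open import Relation.Nullary using (¬_; contradiction)

-- Signs and products in an ordered field.

module OrderedFieldProperties {ℓ} (K : OrderedField ℓ) where
  open OrderedField K
  open IsStrictTotalOrder isStrictTotalOrder public
    using (compare; <-respˡ-≈; <-respʳ-≈; irrefl) renaming (trans to <-trans)
  open RingProperties ring using (-‿distribˡ-*; -‿distribʳ-*; -‿involutive)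
  open Exp semiring using (_^_)

  <-irrefl : ∀ {x} → ¬ x < x
  <-irrefl = irrefl refl

  <-total : ∀ x y → x < y ⊎ x ≈ y ⊎ y < x
  <-total x y with compare x y
  ... | tri< x<y _ _ = inj₁ x<y
  ... | tri≈ _ x≈y _ = inj₂ (inj₁ x≈y)
  ... | tri> _ _ y<x = inj₂ (inj₂ y<x)

  x<0⇒0<-x : ∀ {x} → x < 0# → 0# < - x
  x<0⇒0<-x x<0 = <-respˡ-≈ (-‿inverseʳ _) (<-respʳ-≈ (+-identityˡ _) (+-mono-< _ x<0))

  -x*-x≈x*x : ∀ x → - x * - x ≈ x * x
  -x*-x≈x*x x = begin
    - x * - x    ≈⟨ -‿distribˡ-* x (- x) ⟨
    - (x * - x)  ≈⟨ -‿cong (-‿distribʳ-* x x) ⟨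
    - - (x * x)  ≈⟨ -‿involutive (x * x) ⟩
    x * x        ∎
    where open SetoidReasoning setoid

  x<0⇒0<x*x : ∀ {x} → x < 0# → 0# < x * x
  x<0⇒0<x*x x<0 = <-respʳ-≈ (-x*-x≈x*x _) (*-pos (x<0⇒0<-x x<0) (x<0⇒0<-x x<0))

  0<1 : 0# < 1#
  0<1 with compare 0# 1#
  ... | tri< 0<1 _ _ = 0<1
  ... | tri≈ _ 0≈1 _ = contradiction 0≈1 0≉1
  -- Were 1 negative, its square would be positive, and that square is 1 itself.
  ... | tri> _ _ 1<0 = <-respʳ-≈ (*-identityˡ 1#) (x<0⇒0<x*x 1<0)

  -- Translate `0 < (y - x) * z` by `x * z`.
  *-monoˡ-<-pos : ∀ {x y z} → 0# < z → x < y → x * z < y * z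
  *-monoˡ-<-pos {x} {y} {z} 0<z x<y =
    <-respˡ-≈ (+-identityˡ (x * z)) (<-respʳ-≈ sum (+-mono-< (x * z) (*-pos 0<y-x 0<z)))
    where
    0<y-x : 0# < y - x
    0<y-x = <-respˡ-≈ (-‿inverseʳ x) (+-mono-< (- x) x<y)

    sum : (y - x) * z + x * z ≈ y * z
    sum = begin
      (y - x) * z + x * z  ≈⟨ distribʳ z (y - x) x ⟨
      (y - x + x) * z      ≈⟨ *-congʳ (+-assoc y (- x) x) ⟩
      (y + (- x + x)) * z  ≈⟨ *-congʳ (+-congˡ (-‿inverseˡ x)) ⟩
      (y + 0#) * z         ≈⟨ *-congʳ (+-identityʳ y) ⟩
      y * z                ∎
      where open SetoidReasoning setoid

  ^-pos : ∀ {x} → 0# < x → ∀ n → 0# < x ^ n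
  ^-pos 0<x zero    = 0<1
  ^-pos 0<x (suc n) = *-pos 0<x (^-pos 0<x n)

  0<x*y∧x<0⇒0≮y : ∀ {x y} → 0# < x * y → x < 0# → ¬ 0# < y
  0<x*y∧x<0⇒0≮y 0<xy x<0 0<y =
    <-irrefl (<-trans 0<xy (<-respʳ-≈ (zeroˡ _) (*-monoˡ-<-pos 0<y x<0)))

  -- The second factor only has to be positive where the first is negative, which is
  -- what is known of x ^ (2 * m).
  0<x*y⇒0<x : ∀ {x y} → (x < 0# → 0# < y) → 0# < x * y → 0# < x
  0<x*y⇒0<x {x} x<0⇒0<y 0<xy with compare 0# x
  ... | tri< 0<x _ _ = 0<x
  ... | tri≈ _ 0≈x _ =
    contradiction (<-respʳ-≈ (trans (*-congʳ (sym 0≈x)) (zeroˡ _)) 0<xy) <-irrefl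
  ... | tri> _ _ x<0 = contradiction (x<0⇒0<y x<0) (0<x*y∧x<0⇒0≮y 0<xy x<0)

  inverse-pos : ∀ {x} → 0# < x → ∃ λ y → 0# < y × x * y ≈ 1#
  inverse-pos {x} 0<x with inverse (λ x≈0 → irrefl (sym x≈0) 0<x)
  ... | y , xy≈1 =
    -- The sign lemma is applied to `y * x`, whose second factor is positive outright.
    y , 0<x*y⇒0<x (λ _ → 0<x) (<-respʳ-≈ (trans (sym xy≈1) (*-comm x y)) 0<1) , xy≈1

-- Positive roots in a real closed field.

module RealClosedFieldProperties {ℓ} (R : RealClosedField ℓ) where
  open RealClosedField R
  open OrderedFieldProperties orderedField
  open GroupProperties +-group using (inverseʳ-unique; ⁻¹-involutive)
  open Exp semiring using (_^_; ^-congˡ; ^-assocʳ)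

  square-root-pos : ∀ {x} → 0# < x → ∃ λ y → 0# < y × y * y ≈ x
  square-root-pos {x} 0<x with square-root 0<x
  ... | y , yy≈x with compare 0# y
  ... | tri< 0<y _ _ = y , 0<y , yy≈x
  ... | tri≈ _ 0≈y _ =
    contradiction (<-respʳ-≈ (trans (sym yy≈x) (trans (*-congʳ (sym 0≈y)) (zeroˡ y))) 0<x) <-irrefl
  ... | tri> _ _ y<0 = - y , x<0⇒0<-x y<0 , trans (-x*-x≈x*x y) yy≈x

  -- In Horner form each zero coefficient contributes one factor `x`, and the leading coefficient
  -- contributes 1.
  eval-monomial : ∀ n x → eval (replicate n 0# ∷ʳ 1#) x ≈ x ^ n
  eval-monomial zero    x = trans (+-congˡ (zeroʳ x)) (+-identityʳ 1#)
  eval-monomial (suc n) x = trans (+-identityˡ _) (*-congˡ (eval-monomial n x))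

  x<0⇒0<x^2m : ∀ {x} m → x < 0# → 0# < x ^ (2 ℕ.* m)
  x<0⇒0<x^2m {x} m x<0 = <-respʳ-≈
    -- `x ^ 2` unfolds to `x * (x * 1)`, so the last factor has to be absorbed before raising to the
    -- power `m`.
    (trans (^-congˡ m (*-congˡ (sym (*-identityʳ x)))) (^-assocʳ x 2 m))
    (^-pos (x<0⇒0<x*x x<0) m)

  -- A root of X^(2m+1) - a satisfies x * x^(2m) = a > 0. A negative x would make x^(2m) positive
  -- and the product negative, so x is positive.
  odd-root-pos : ∀ m {a} → 0# < a → ∃ λ x → 0# < x × x ^ suc (2 ℕ.* m) ≈ a
  odd-root-pos m {a} 0<a with odd-root m (- a ∷ replicate (2 ℕ.* m) 0#) (λ 1≈0 → 0≉1 (sym 1≈0))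
  ... | x , root = x , 0<x*y⇒0<x (x<0⇒0<x^2m m) (<-respʳ-≈ (sym power) 0<a) , power
    where
    power : x ^ suc (2 ℕ.* m) ≈ a
    power = trans (*-congˡ (sym (eval-monomial (2 ℕ.* m) x)))
      -- The root equation reads `- a + x * r ≈ 0`, hence `x * r` is the negative of `- a`.
      (trans (inverseʳ-unique _ _ root) (⁻¹-involutive a))

  nth-root-pos : ∀ k .{{_ : ℕ.NonZero k}} {a} → 0# < a → ∃ λ x → 0# < x × x ^ k ≈ a
  nth-root-pos k = <-rec (λ k → .{{_ : ℕ.NonZero k}} → ∀ {a} → 0# < a → ∃ λ x → 0# < x × x ^ k ≈ a)
    step k
    where
    step : ∀ k → (∀ {j} → j ℕ.< k → .{{_ : ℕ.NonZero j}} →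
                    ∀ {a} → 0# < a → ∃ λ x → 0# < x × x ^ j ≈ a) →
           .{{_ : ℕ.NonZero k}} → ∀ {a} → 0# < a → ∃ λ x → 0# < x × x ^ k ≈ a
    step k rec 0<a with k divMod 2
    -- Even case. The quotient is a successor because `k` is nonzero, so it is again a legitimate
    -- exponent for the recursive call on the square root `b`.
    ... | result (suc m) zero ≡.refl with square-root-pos 0<a
    ...   | b , 0<b , bb≈a with rec {suc m} (ℕ.m<m*n (suc m) 2 (ℕ.s≤s (ℕ.s≤s ℕ.z≤n))) 0<b
    ...     | x , 0<x , x^m≈b = x , 0<x , (begin
      x ^ (suc m ℕ.* 2)          ≈⟨ ^-assocʳ x (suc m) 2 ⟨
      (x ^ suc m) ^ 2            ≈⟨ ^-congˡ 2 x^m≈b ⟩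
      b * (b * 1#)               ≈⟨ *-congˡ (*-identityʳ b) ⟩
      b * b                      ≈⟨ bb≈a ⟩
      _                          ∎)
      where open SetoidReasoning setoid
    -- Odd case, without recursion: `k` is `1 + m * 2`, commuted to the exponent of `odd-root-pos`.
    step k rec 0<a | result m (suc zero) ≡.refl rewrite ℕ.*-comm m 2 = odd-root-pos m 0<a

-- The structure pulled back along `h`.

module PullbackProperties {p ℓ} {F : Subfield p} (R : RealClosedField ℓ)
                          {F⊆R : OrderedSubfieldOf F R} (h-bij : FBijection F⊆R) where
  private module F = Subfield F
  open RealClosedField R
  open OrderedFieldProperties orderedField
  open RealClosedFieldProperties R
  open OrderedSubfieldOf F⊆R
  open IsRingMonomorphism isRingMonomorphism using (+-homo; *-homo; 0#-homo)
  open FBijection h-bij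
  open Exp semiring using (_^_; ^-congˡ)
  open Structure (h-bij ⁻¹[ R ]) using (_⊗_; ⟦_⟧; Sat)
  open SetoidReasoning setoid

  h-⊗ : ∀ x y → h (x ⊗ y) ≈ h x * h y
  h-⊗ x y = h∘h⁻¹ (h x * h y)

  -- The order is total, and either alternative to `x < y` is carried by `h` to a contradiction with
  -- `h x < h y`.
  h-cancel-< : ∀ {x y} → h x < h y → x < y
  h-cancel-< {x} {y} hx<hy with compare x y
  ... | tri< x<y _ _ = x<y
  ... | tri≈ _ x≈y _ = contradiction hx<hy (irrefl (h-cong x≈y))
  ... | tri> _ _ y<x = contradiction (<-trans hx<hy (order y<x)) <-irrefl

  h-pos : ∀ {x} → 0# < x → 0# < h x
  h-pos 0<x = <-respˡ-≈ h-0 (order 0<x)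

  h-cancel-pos : ∀ {x} → 0# < h x → 0# < x
  h-cancel-pos 0<hx = h-cancel-< (<-respˡ-≈ (sym h-0) 0<hx)

  h⁻¹-pos : ∀ {y} → 0# < y → 0# < h⁻¹ y
  h⁻¹-pos 0<y = h-cancel-pos (<-respʳ-≈ (sym (h∘h⁻¹ _)) 0<y)

  h-ι : ∀ a → h (ι a) ≈ ι a
  h-ι a = begin
    h (ι a)       ≈⟨ h-cong (*-identityʳ (ι a)) ⟨
    h (ι a * 1#)  ≈⟨ homogeneous a 1# ⟩
    ι a * h 1#    ≈⟨ *-congˡ h-1 ⟩
    ι a * 1#      ≈⟨ *-identityʳ (ι a) ⟩
    ι a           ∎

  -- This turns the axioms on constants into ring identities of `R`: `h` fixes `ι a` and is
  -- homogeneous, so both sides have image `ι a * h x`.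
  ι-⊗ : ∀ a x → ι a ⊗ x ≈ ι a * x
  ι-⊗ a x = injective (begin
    h (ι a ⊗ x)    ≈⟨ h-⊗ (ι a) x ⟩
    h (ι a) * h x  ≈⟨ *-congʳ (h-ι a) ⟩
    ι a * h x      ≈⟨ homogeneous a x ⟨
    h (ι a * x)    ∎)

  -- Ordered abelian group laws for `⊗`.

  ⊗-pos : ∀ {x y} → 0# < x → 0# < y → 0# < x ⊗ y
  ⊗-pos 0<x 0<y = h⁻¹-pos (*-pos (h-pos 0<x) (h-pos 0<y))

  -- By injectivity it suffices to compare images under `h`, where `⊗` becomes `*`. The equational
  -- laws below follow the same pattern.
  ⊗-assoc : ∀ x y z → (x ⊗ y) ⊗ z ≈ x ⊗ (y ⊗ z)
  ⊗-assoc x y z = injective (begin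
    h ((x ⊗ y) ⊗ z)    ≈⟨ h-⊗ (x ⊗ y) z ⟩
    h (x ⊗ y) * h z    ≈⟨ *-congʳ (h-⊗ x y) ⟩
    h x * h y * h z    ≈⟨ *-assoc (h x) (h y) (h z) ⟩
    h x * (h y * h z)  ≈⟨ *-congˡ (h-⊗ y z) ⟨
    h x * h (y ⊗ z)    ≈⟨ h-⊗ x (y ⊗ z) ⟨
    h (x ⊗ (y ⊗ z))    ∎)

  ⊗-comm : ∀ x y → x ⊗ y ≈ y ⊗ x
  ⊗-comm x y = injective (begin
    h (x ⊗ y)  ≈⟨ h-⊗ x y ⟩
    h x * h y  ≈⟨ *-comm (h x) (h y) ⟩
    h y * h x  ≈⟨ h-⊗ y x ⟨
    h (y ⊗ x)  ∎)

  ⊗-identityʳ : ∀ x → x ⊗ 1# ≈ x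
  ⊗-identityʳ x = injective (begin
    h (x ⊗ 1#)  ≈⟨ h-⊗ x 1# ⟩
    h x * h 1#  ≈⟨ *-congˡ h-1 ⟩
    h x * 1#    ≈⟨ *-identityʳ (h x) ⟩
    h x         ∎)

  ⊗-inverse : ∀ {x} → 0# < x → ∃ λ y → 0# < y × x ⊗ y ≈ 1#
  ⊗-inverse {x} 0<x with inverse-pos (h-pos 0<x)
  ... | y , 0<y , hx*y≈1 = h⁻¹ y , h⁻¹-pos 0<y , injective (begin
    h (x ⊗ h⁻¹ y)    ≈⟨ h-⊗ x (h⁻¹ y) ⟩
    h x * h (h⁻¹ y)  ≈⟨ *-congˡ (h∘h⁻¹ y) ⟩
    h x * y          ≈⟨ hx*y≈1 ⟩
    1#               ≈⟨ h-1 ⟨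
    h 1#             ∎)

  ⊗-monoˡ-< : ∀ {x y z} → 0# < z → x < y → x ⊗ z < y ⊗ z
  ⊗-monoˡ-< 0<z x<y = h-cancel-<
    (<-respˡ-≈ (sym (h-⊗ _ _)) (<-respʳ-≈ (sym (h-⊗ _ _)) (*-monoˡ-<-pos (h-pos 0<z) (order x<y))))

  -- Links the syntactic powers of the divisibility axioms to powers in `R`; both are built by
  -- multiplying on the left, starting from 1.
  h-⟦power⟧ : ∀ {n} (t : Term F.Carrier n) k ρ →
              h (⟦ PositiveMultiplicative.power t k ⟧ ρ) ≈ h (⟦ t ⟧ ρ) ^ k
  h-⟦power⟧ t zero    ρ = h-1
  h-⟦power⟧ t (suc k) ρ = trans (h-⊗ _ _) (*-congˡ (h-⟦power⟧ t k ρ))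

  -- Verification of the axioms.

  additive : ∀ {φ} → Additive.Axiom φ → Sat φ []
  -- The domain formula is `⊥̇ ⇒̇ ⊥̇`, so membership is proved by the identity function.
  additive Additive.closed      = λ _ _ _ _ z → z
  additive Additive.e-closed    = λ z → z
  additive Additive.associative = λ x _ y _ z _ → +-assoc x y z
  additive Additive.commutative = λ x _ y _ → +-comm x y
  additive Additive.identity    = λ x _ → +-identityʳ x
  additive Additive.inverse     = λ x _ → - x , (λ z → z) , -‿inverseʳ x
  additive Additive.irreflexive = λ _ _ x<x → contradiction x<x <-irrefl
  additive Additive.transitive  = λ _ _ _ _ _ _ → <-trans
  additive Additive.total       = λ x _ y _ → <-total x y
  additive Additive.monotone    = λ _ _ _ _ z _ → +-mono-< z

  multiplicative : ∀ {φ} → PositiveMultiplicative.Axiom φ → Sat φ []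
  multiplicative PositiveMultiplicative.closed      = λ _ 0<x _ 0<y → ⊗-pos 0<x 0<y
  multiplicative PositiveMultiplicative.e-closed    = 0<1
  multiplicative PositiveMultiplicative.associative = λ x _ y _ z _ → ⊗-assoc x y z
  multiplicative PositiveMultiplicative.commutative = λ x _ y _ → ⊗-comm x y
  multiplicative PositiveMultiplicative.identity    = λ x _ → ⊗-identityʳ x
  multiplicative PositiveMultiplicative.inverse     = λ _ 0<x → ⊗-inverse 0<x
  multiplicative PositiveMultiplicative.irreflexive = λ _ _ x<x → contradiction x<x <-irrefl
  multiplicative PositiveMultiplicative.transitive  = λ _ _ _ _ _ _ → <-trans
  multiplicative PositiveMultiplicative.total       = λ x _ y _ → <-total x y
  multiplicative PositiveMultiplicative.monotone    = λ _ _ _ _ _ 0<z → ⊗-monoˡ-< 0<z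

  divisibility : ∀ {φ} → PositiveMultiplicative.Divisibility φ → Sat φ []
  -- The root is extracted from `h x` in `R` and then pulled back.
  divisibility (PositiveMultiplicative.divisible k) x 0<x with nth-root-pos k (h-pos 0<x)
  ... | y , 0<y , y^k≈hx = h⁻¹ y , h⁻¹-pos 0<y ,
    injective (trans (h-⟦power⟧ (v 0) k (h⁻¹ y ∷ x ∷ [])) (trans (^-congˡ k (h∘h⁻¹ y)) y^k≈hx))

  models : h-bij ⁻¹[ R ] ⊨ T[ F ]*
  models (ax1 φ∈)       = additive φ∈
  models (ax2 φ∈)       = multiplicative φ∈
  models (ax2′ φ∈)      = divisibility φ∈
  models (ax3a a b)     = +-homo a b
  -- The axiom's product is `⊗`, which agrees with `*` when the left factor is a constant.
  models (ax3b a b)     = trans (*-homo a b) (sym (ι-⊗ a (ι b)))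
  models (ax3c a 0<a)   = <-respˡ-≈ 0#-homo (IsOrderMonomorphism.mono isOrderMonomorphism 0<a)
  models (ax4a a b) x   = begin
    ι (a F.+ b) ⊗ x        ≈⟨ ι-⊗ (a F.+ b) x ⟩
    ι (a F.+ b) * x        ≈⟨ *-congʳ (+-homo a b) ⟩
    (ι a + ι b) * x        ≈⟨ distribʳ x (ι a) (ι b) ⟩
    ι a * x + ι b * x      ≈⟨ +-cong (ι-⊗ a x) (ι-⊗ b x) ⟨
    (ι a ⊗ x) + (ι b ⊗ x)  ∎
  models (ax4b a) x y   = begin
    ι a ⊗ (x + y)          ≈⟨ ι-⊗ a (x + y) ⟩
    ι a * (x + y)          ≈⟨ distribˡ (ι a) x y ⟩
    ι a * x + ι a * y      ≈⟨ +-cong (ι-⊗ a x) (ι-⊗ a y) ⟨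
    (ι a ⊗ x) + (ι a ⊗ y)  ∎

theorem9p2 : ∀ {p ℓ} (F : Subfield p) → Countable F →
    (R : RealClosedField ℓ) (F⊆R : OrderedSubfieldOf F R)
    (h : FBijection F⊆R) →
    h ⁻¹[ R ] ⊨ T[ F ]*
theorem9p2 F _ R F⊆R h = PullbackProperties.models R h
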